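{- Let $U$ be a nonempty finite set. For every closure operation $f\in Cl(U)$, the set of all minimal keys of $f$ equals the family of all minimal transversals of the family of minimal independent sets of $f$: $$Key(f)=Tr(MI(f)).$$
   Context: Let $U$ be a nonempty finite set with power set $\mathcal{P}(U)$. A closure operation on $U$ is a map $f:\mathcal{P}(U)\to\mathcal{P}(U)$ such that for all $X,Y\subseteq U$: $X\subseteq f(X)$; $X\subseteq Y$ implies $f(X)\subseteq f(Y)$; and $f(f(X))=f(X)$. $Cl(U)$ is the set of all closure operations on $U$. A set $K\subseteq U$ is a key of $f$ if $f(K)=U$; a key $K$ is minimal if for every $a\in K$ the set $K\setminus\{a\}$ is not a key. $Key(f)$ is the set of all minimal keys of $f$. For $X\subseteq U$ put $I(X)=\{a\in U: a\notin f(X)\}=U\setminus f(X)$; such a set is called an independent set of $f$, and $I(f)=\{I(X):X\subseteq U\}$ is the family of all independent sets of $f$. $MI(f)$, the family of all minimal independent sets of $f$, consists of the inclusion-minimal nonempty members of $I(f)$, i.e. those $Y\in I(f)$ with $Y\neq\emptyset$ such that no nonempty $Z\in I(f)$ satisfies $Z\subsetneq Y$. For a family $\mathcal{H}$ of subsets of $U$ (a hypergraph; empty families and empty edges are allowed), a transversal of $\mathcal{H}$ is a set $T\subseteq U$ with $T\cap E\neq\emptyset$ for all $E\in\mathcal{H}$; it is minimal if no proper subset of $T$ is a transversal. $Tr(\mathcal{H})$ is the family of all minimal transversals of $\mathcal{H}$. In particular $Tr(\emptyset)=\{\emptyset\}$ and $Tr(\{\emptyset\})=\emptyset$. -}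

module Defs where

open import Data.Fin.Subset using (Subset; _∈_; _⊆_; _⊂_; _⊄_; _∩_; _-_; ∁; ⊤; Nonempty)
open import Data.Nat.Base using (ℕ)
open import Data.Product.Base using (_×_; ∃)
open import Level using (0ℓ)
open import Relation.Binary.PropositionalEquality using (_≡_)
open import Relation.Nullary using (¬_)
open import Relation.Unary using (Pred)

-- The finite set U of the mathematics is Fin n, and its power set is Subset n
-- (Boolean vectors), so that _≡_ on Subset n is extensional equality of sets.

record ClosureOperation (n : ℕ) : Set where
  field
    cl         : Subset n → Subset n
    extensive  : ∀ X → X ⊆ cl X
    monotone   : ∀ X Y → X ⊆ Y → cl X ⊆ cl Y
    idempotent : ∀ X → cl (cl X) ≡ cl X

open ClosureOperation public

Family : ℕ → Set₁
Family n = Pred (Subset n) 0ℓ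

IsKey : ∀ {n} → ClosureOperation n → Family n
IsKey f K = cl f K ≡ ⊤

Key : ∀ {n} → ClosureOperation n → Family n
Key f K = IsKey f K × (∀ a → a ∈ K → ¬ IsKey f (K - a))

independentSet : ∀ {n} → ClosureOperation n → Subset n → Subset n
independentSet f X = ∁ (cl f X)

I : ∀ {n} → ClosureOperation n → Family n
I f Y = ∃ λ X → Y ≡ independentSet f X

MI : ∀ {n} → ClosureOperation n → Family n
MI f Y = I f Y × Nonempty Y × (∀ Z → I f Z → Nonempty Z → Z ⊄ Y)

IsTransversal : ∀ {n} → Family n → Family n
IsTransversal H T = ∀ E → H E → Nonempty (T ∩ E)

Tr : ∀ {n} → Family n → Family n
Tr H T = IsTransversal H T × (∀ S → S ⊂ T → ¬ IsTransversal H S)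

{-# OPTIONS --safe #-}
-- K is a key exactly when it meets every minimal independent set. A key missing
-- U ∖ f(X) lies in f(X), so f(X) = U; conversely, if f(K) ≠ U then U ∖ f(K) is a
-- nonempty independent set disjoint from K, and so is any minimal one inside it.
-- Both sides are the minimal members of this common, upward closed family.
module Submission where

open import Data.Bool.Properties using () renaming (_≟_ to _≟ᵇ_)
open import Data.Fin.Subset
open import Data.Fin.Subset.Induction using (⊂-wellFounded)
open import Data.Fin.Subset.Properties
open import Data.Nat.Base using (ℕ; NonZero)
open import Data.Product.Base using (_×_; _,_; ∃)
open import Data.Vec.Properties using (≡-dec)
open import Function.Base using (_∘_)
open import Induction.WellFounded using (Acc; acc)
open import Relation.Binary.PropositionalEquality using (_≡_; refl; sym; subst)
open import Relation.Nullary using (yes; no; contradiction)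
open import Relation.Nullary.Decidable using (_×-dec_; decidable-stable)
open import Relation.Unary using (_≐_; Decidable)
open import Defs

private
  variable
    n : ℕ

⊤⊆⇒≡⊤ : {p : Subset n} → ⊤ ⊆ p → p ≡ ⊤
⊤⊆⇒≡⊤ ⊤⊆p = ⊆-antisym ⊆⊤ ⊤⊆p

-- Descent along the well-founded `⊂`: decidability of `P` lets a search over all subsets either
-- find a strictly smaller member to continue from or certify minimality.
minimal-below : {P : Family n} → Decidable P → ∀ {Y} → P Y →
                ∃ λ Z → P Z × Z ⊆ Y × (∀ W → P W → W ⊄ Z)
minimal-below {P = P} P? {Y} = go (⊂-wellFounded Y)
  where
  go : ∀ {Y} → Acc _⊂_ Y → P Y → ∃ λ Z → P Z × Z ⊆ Y × (∀ W → P W → W ⊄ Z)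
  go {Y} (acc rec) PY with anySubset? (λ W → P? W ×-dec W ⊂? Y)
  ... | no ∄W = Y , PY , ⊆-refl , λ W PW W⊂Y → ∄W (W , PW , W⊂Y)
  ... | yes (W , PW , W⊂Y) with go (rec W⊂Y) PW
  ...   | Z , PZ , Z⊆W , Z-min = Z , PZ , p⊂q⇒p⊆q W⊂Y ∘ Z⊆W , Z-min

module _ (f : ClosureOperation n) where

  I? : Decidable (I f)
  I? Y = anySubset? (λ X → ≡-dec _≟ᵇ_ Y (independentSet f X))

  MI-below : ∀ {Y} → I f Y → Nonempty Y → ∃ λ E → MI f E × E ⊆ Y
  -- Nonemptiness is part of the predicate, since otherwise the descent could end at the empty set,
  -- which is independent as the complement of `cl f ⊤`.
  MI-below IY Y≢∅ with minimal-below (λ Z → I? Z ×-dec nonempty? Z) (IY , Y≢∅)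
  ... | E , (IE , E≢∅) , E⊆Y , E-min =
    E , (IE , E≢∅ , λ Z IZ Z≢∅ → E-min Z (IZ , Z≢∅)) , E⊆Y

  key-mono : ∀ {K L} → K ⊆ L → IsKey f K → IsKey f L
  key-mono {K} {L} K⊆L key = ⊤⊆⇒≡⊤ (subst (_⊆ cl f L) key (monotone f K L K⊆L))

  key-meets-I : ∀ {K} → IsKey f K → ∀ {E} → I f E → Nonempty E → Nonempty (K ∩ E)
  key-meets-I {K} key (X , refl) (e , e∈E) =
    decidable-stable (nonempty? (K ∩ ∁ (cl f X))) λ K∩E≡∅ →
      let K⊆clX : K ⊆ cl f X
          K⊆clX x∈K = x∉∁p⇒x∈p λ x∈E → K∩E≡∅ (_ , x∈p∩q⁺ (x∈K , x∈E))
          clX≡⊤ : cl f X ≡ ⊤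
          -- A superset of a key is a key, so `cl f (cl f X)` is `⊤`; idempotence removes the outer
          -- closure.
          clX≡⊤ = subst (_≡ ⊤) (idempotent f X) (key-mono K⊆clX key)
      in x∈∁p⇒x∉p e∈E (subst (e ∈_) (sym clX≡⊤) ∈⊤)

  key⇒transversal : ∀ {K} → IsKey f K → IsTransversal (MI f) K
  key⇒transversal key _ (IE , E≢∅ , _) = key-meets-I key IE E≢∅

  transversal⇒key : ∀ {T} → IsTransversal (MI f) T → IsKey f T
  transversal⇒key {T} T-tr with nonempty? (independentSet f T)
  ... | no I≡∅ = ⊤⊆⇒≡⊤ λ _ → x∉∁p⇒x∈p λ x∈I → I≡∅ (_ , x∈I)
  ... | yes I≢∅ with MI-below (T , refl) I≢∅
  ...   | E , ME , E⊆I with T-tr E ME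
  ...     | x , x∈T∩E with x∈p∩q⁻ T E x∈T∩E
  -- The common point would lie both in `cl f T` and in its complement.
  ...       | x∈T , x∈E = contradiction (extensive f T x∈T) (x∈∁p⇒x∉p (E⊆I x∈E))

corollary3p1 : ∀ (n : ℕ) .{{_ : NonZero n}} (f : ClosureOperation n) → Key f ≐ Tr (MI f)
corollary3p1 n f = Key⊆Tr , Tr⊆Key
  where
  Key⊆Tr : ∀ {K} → Key f K → Tr (MI f) K
  Key⊆Tr {K} (key , K-min) = key⇒transversal f key , λ where
    -- Minimality of keys tests only one-point deletions. The point `a` that `S` misses puts `S`
    -- inside `K - a`, and keys are upward closed.
    S (S⊆K , a , a∈K , a∉S) S-tr →
      let S⊆K-a : S ⊆ K - a
          S⊆K-a x∈S = x∈p∧x≢y⇒x∈p-y (S⊆K x∈S) λ { refl → a∉S x∈S }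
      in K-min a a∈K (key-mono f S⊆K-a (transversal⇒key f S-tr))

  Tr⊆Key : ∀ {T} → Tr (MI f) T → Key f T
  Tr⊆Key {T} (T-tr , T-min) = transversal⇒key f T-tr , λ a a∈T key →
    T-min (T - a) (x∈p⇒p-x⊂p a∈T) (key⇒transversal f key)
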